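{- Let $B$ be an abelian group equipped with an infinite family of group homomorphisms $r_v\colon B\to B_v$ (indexed by primes $v$ of a number field $F$) into finite abelian groups $B_v$, satisfying Assumptions (A1) and (A2) described in the context. Let $P,Q\in B$ be points of infinite order. Then the following are equivalent: (i) for all but finitely many $v$ there exist coprime integers $x,y$ and a point $T\in B_{\mathrm{tors}}$ such that $r_v(x^2P+y^2Q)=r_v(T)$; (ii) there exist coprime integers $x,y$ and a point $T\in B_{\mathrm{tors}}$ such that $x^2P+y^2Q=T$.
   Context: Setting: $F$ is a number field, $B$ an abelian group, and $r_v\colon B\to B_v$ an infinite family of group homomorphisms indexed by primes $v$ of $F$, with each $B_v$ a finite abelian group. $B_{\mathrm{tors}}$ denotes the torsion subgroup of $B$. For $P\in B$, $\mathrm{ord}_v P$ denotes the order of $r_v(P)$ in $B_v$. For a prime $l$ and positive integer $k$, $l^k\parallel n$ means $l^k\mid n$ and $l^{k+1}\nmid n$. Assumption (A1): for every prime number $l$, every sequence $(k_1,\dots,k_m)$ of nonnegative integers, and every points $P_1,\dots,P_m\in B$ linearly independent over $\mathbb{Z}$, there is a set of primes $v$ of $F$ of positive density such that for each $i$, $l^{k_i}\parallel \mathrm{ord}_v P_i$ if $k_i>0$ and $l\nmid \mathrm{ord}_v P_i$ if $k_i=0$. Assumption (A2): for all but finitely many $v$ the restriction of $r_v$ to $B_{\mathrm{tors}}$ is injective. (Examples: $S$-unit groups of a number field, Mordell–Weil groups $A(F)$ of abelian varieties with $\mathrm{End}_{\bar F}(A)=\mathbb{Z}$, odd $K$-groups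 $K_{2n+1}(F)$, $n>0$, with reduction maps.) -}

module Defs where

open import Algebra.Apartness using (HeytingField; HeytingCommutativeRing)
open import Algebra.Bundles using (AbelianGroup; CommutativeRing; Semiring)
open import Algebra.Morphism.Bundles using (GroupHomomorphism; RingHomomorphism)
import Algebra.Definitions.RawMonoid as RawMonoidDefs
import Algebra.Definitions.RawSemiring as RawSemiringDefs
open import Data.Fin.Base using (Fin; toℕ)
open import Data.Integer.Base as ℤ using (ℤ; +_; -[1+_])
open import Data.List.Base using (List)
open import Data.List.Membership.Propositional using () renaming (_∈_ to _∈ˡ_)
open import Data.Nat.Base using (ℕ; suc; _≤_; _<_; _^_)
open import Data.Nat.Divisibility using (_∣_; _∤_)
open import Data.Nat.Primality using (Prime)
open import Data.Product.Base using (Σ-syntax; ∃-syntax; _×_; proj₁)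
open import Data.Rational.Base as ℚ using (ℚ; 0ℚ)
import Data.Rational.Properties as ℚ
open import Data.Sum.Base using (_⊎_)
open import Data.Vec.Functional using (Vector)
open import Function.Definitions using (Bijective; Injective)
open import Level using (Level; 0ℓ) renaming (suc to lsuc; _⊔_ to _⊔ˡ_)
open import Relation.Binary.Core using (Rel)
open import Relation.Binary.PropositionalEquality.Core using (_≡_)
open import Relation.Nullary.Negation using (¬_)
open import Relation.Unary using (Pred; U; _∈_; _∉_; _≐_)

private
  variable
    a r p ℓ : Level

------------------------------------------------------------------------
-- Finiteness

-- The quotient of A by _~_ has exactly n elements: f is a complete,
-- irredundant system of representatives.
HasSize : {A : Set a} → Rel A r → ℕ → Set (a ⊔ˡ r)
HasSize {A = A} _~_ n = ∃[ f ] Bijective {A = Fin n} {B = A} _≡_ _~_ f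

IsFinite : Set a → Set a
IsFinite A = Σ[ xs ∈ List A ] (∀ x → x ∈ˡ xs)

AllButFinitelyMany : {A : Set a} → Pred A p → Set (a ⊔ˡ p)
AllButFinitelyMany {A = A} R = Σ[ xs ∈ List A ] (∀ x → ¬ (x ∈ˡ xs) → R x)

------------------------------------------------------------------------
-- Exact divisibility, written  l ^ k ∥ n  in the literature

ExactPower : ℕ → ℕ → ℕ → Set
ExactPower l k n = (l ^ k ∣ n) × (l ^ suc k ∤ n)

------------------------------------------------------------------------
-- Abelian groups as ℤ-modules

module ℤ-Action (G : AbelianGroup a r) where
  open AbelianGroup G
  open RawMonoidDefs rawMonoid public using (sum) renaming (_×_ to _×ᴳ_)

  infixr 8 _·_

  _·_ : ℤ → Carrier → Carrier
  (+ n)    · g = n ×ᴳ g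
  -[1+ n ] · g = (suc n ×ᴳ g) ⁻¹

  IsOrder : Carrier → ℕ → Set r
  IsOrder g n =
    0 < n × (n ×ᴳ g ≈ ε) × (∀ m → 0 < m → m ×ᴳ g ≈ ε → n ≤ m)

  IsTorsion : Pred Carrier r
  IsTorsion g = ∃[ n ] (0 < n × n ×ᴳ g ≈ ε)

  InfiniteOrder : Pred Carrier r
  InfiniteOrder g = ¬ IsTorsion g

  LinearlyIndependent : ∀ {m} → Vector Carrier m → Set r
  LinearlyIndependent {m} P =
    (c : Vector ℤ m) → sum (λ i → c i · P i) ≈ ε → ∀ i → c i ≡ ℤ.0ℤ

------------------------------------------------------------------------
-- Real numbers, as Cauchy sequences of rationals

record ℝ : Set where
  field
    approx : ℕ → ℚ
    cauchy : ∀ ε → 0ℚ ℚ.< ε →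
             ∃[ M ] (∀ m n → M ≤ m → M ≤ n → ℚ.∣ approx m ℚ.- approx n ∣ ℚ.< ε)

open ℝ public using (approx)

Positive : Pred ℝ 0ℓ
Positive d = ∃[ δ ] (0ℚ ℚ.< δ × ∃[ M ] (∀ m → M ≤ m → δ ℚ.≤ approx d m))

------------------------------------------------------------------------
-- Number fields: finite extensions of ℚ

record NumberField ℓ : Set (lsuc ℓ) where
  field
    heytingField : HeytingField ℓ ℓ ℓ

  commutativeRing : CommutativeRing ℓ ℓ
  commutativeRing = HeytingCommutativeRing.commutativeRing
    (HeytingField.heytingCommutativeRing heytingField)

  open CommutativeRing commutativeRing public
  open RawSemiringDefs (Semiring.rawSemiring semiring) public
    using () renaming (sum to sumᶠ; _^_ to _^ᶠ_)

  field
    fromℚ : RingHomomorphism (CommutativeRing.rawRing ℚ.+-*-commutativeRing) rawRing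

  open RingHomomorphism fromℚ public using () renaming (⟦_⟧ to ι)

  field
    generators : ∃[ d ] Σ[ b ∈ Vector Carrier d ]
      (∀ x → Σ[ q ∈ Vector ℚ d ] (x ≈ sumᶠ (λ i → ι (q i) * b i)))

  -- x is a root of the monic polynomial Xⁿ + Σ_{i<n} cᵢ Xⁱ over ℤ.
  IsIntegral : Pred Carrier ℓ
  IsIntegral x = ∃[ n ] Σ[ c ∈ Vector ℤ n ]
    (x ^ᶠ n + sumᶠ (λ i → ι (c i ℚ./ 1) * x ^ᶠ toℕ i) ≈ 0#)

-- The primes of a number field are the nonzero prime ideals of its ring
-- of integers, taken as subsets of the field.  They are compared with _≐_
-- on these subsets.
record PrimeIdeal (F : NumberField ℓ) : Set (lsuc ℓ) where
  open NumberField F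
  field
    ideal     : Pred Carrier ℓ
    integral  : ∀ {x} → x ∈ ideal → IsIntegral x
    resp      : ∀ {x y} → x ≈ y → x ∈ ideal → y ∈ ideal
    0-closed  : 0# ∈ ideal
    +-closed  : ∀ {x y} → x ∈ ideal → y ∈ ideal → x + y ∈ ideal
    *-closed  : ∀ {x y} → IsIntegral x → y ∈ ideal → x * y ∈ ideal
    proper    : 1# ∉ ideal
    nonzero   : ∃[ x ] (x ∈ ideal × ¬ (x ≈ 0#))
    prime     : ∀ {x y} → IsIntegral x → IsIntegral y →
                x * y ∈ ideal → x ∈ ideal ⊎ y ∈ ideal

open PrimeIdeal public using (ideal)

module _ (F : NumberField ℓ) where
  open NumberField F

  -- The absolute norm: the cardinality of the residue ring.
  IsNorm : PrimeIdeal F → ℕ → Set ℓ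
  IsNorm 𝔭 = HasSize {A = ∃[ x ] IsIntegral x}
    (λ x y → proj₁ x - proj₁ y ∈ ideal 𝔭)

  CountUpTo : (PrimeIdeal F → ℕ) → Pred (PrimeIdeal F) p → ℕ → ℕ → Set (lsuc ℓ ⊔ˡ p)
  CountUpTo N S x = HasSize {A = ∃[ 𝔭 ] (𝔭 ∈ S × N 𝔭 ≤ x)}
    (λ 𝔭 𝔮 → ideal (proj₁ 𝔭) ≐ ideal (proj₁ 𝔮))

  -- Natural density:  #{𝔭 ∈ S : N𝔭 ≤ x} / #{𝔭 : N𝔭 ≤ x} → d  as x → ∞.
  -- That norms and counts are finite and the denominator eventually
  -- nonzero is part of the assertion that the limit makes sense.
  HasDensity : Pred (PrimeIdeal F) p → ℝ → Set (lsuc ℓ ⊔ˡ p)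
  HasDensity S d =
    Σ[ N ∈ (PrimeIdeal F → ℕ) ] ((∀ 𝔭 → IsNorm 𝔭 (N 𝔭)) ×
      (∀ ε → 0ℚ ℚ.< ε → ∃[ X ] (∀ x → X ≤ x →
        ∃[ s ] ∃[ t ] (CountUpTo N S x s × CountUpTo N U x (suc t) ×
          (∀ m → X ≤ m → ℚ.∣ (+ s) ℚ./ suc t ℚ.- approx d m ∣ ℚ.< ε)))))

------------------------------------------------------------------------
-- Families of reduction maps

-- The family is indexed by an infinite set of primes of F, possibly not
-- all of them (S-unit groups have no reduction at the primes of S).  This
-- set is presented as the image of an injection from V, so that each prime
-- has a single reduction map.
record ReductionFamily (F : NumberField ℓ) (B : AbelianGroup ℓ ℓ) : Set (lsuc ℓ) where
  field
    V              : Set ℓ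
    toPrime        : V → PrimeIdeal F
    injective      : Injective _≡_ (λ 𝔭 𝔮 → ideal 𝔭 ≐ ideal 𝔮) toPrime
    infinite       : ¬ IsFinite V
    group          : V → AbelianGroup ℓ ℓ
    finite         : ∀ v → ∃[ n ] HasSize (AbelianGroup._≈_ (group v)) n
    reduction      : ∀ v → GroupHomomorphism (AbelianGroup.rawGroup B)
                                             (AbelianGroup.rawGroup (group v))

  red : ∀ v → AbelianGroup.Carrier B → AbelianGroup.Carrier (group v)
  red v = GroupHomomorphism.⟦_⟧ (reduction v)

  infix 4 _≈[_]_

  _≈[_]_ : AbelianGroup.Carrier B → V → AbelianGroup.Carrier B → Set ℓ
  P ≈[ v ] Q = AbelianGroup._≈_ (group v) (red v P) (red v Q)

  IsOrd : V → AbelianGroup.Carrier B → ℕ → Set ℓ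
  IsOrd v P = ℤ-Action.IsOrder (group v) (red v P)

  primesOf : Pred V ℓ → Pred (PrimeIdeal F) ℓ
  primesOf S 𝔭 = ∃[ v ] (v ∈ S × ideal 𝔭 ≐ ideal (toPrime v))

module _ {F : NumberField ℓ} {B : AbelianGroup ℓ ℓ} (ρ : ReductionFamily F B) where
  open AbelianGroup B
  open ℤ-Action B
  open ReductionFamily ρ

  AssumptionA1 : Set (lsuc ℓ)
  AssumptionA1 =
    ∀ l → Prime l → ∀ m → 1 ≤ m → (k : Vector ℕ m) (P : Vector Carrier m) →
    LinearlyIndependent P →
    Σ[ S ∈ Pred V ℓ ]
      (∃[ d ] (HasDensity F (primesOf S) d × Positive d)) ×
      (∀ v → v ∈ S → ∀ i → ∃[ n ] (IsOrd v (P i) n ×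
        (0 < k i → ExactPower l (k i) n) ×
        (k i ≡ 0 → l ∤ n)))

  AssumptionA2 : Set ℓ
  AssumptionA2 = AllButFinitelyMany λ v →
    ∀ {S T} → IsTorsion S → IsTorsion T → S ≈[ v ] T → S ≈ T

{-# OPTIONS --safe #-}

-- For the nontrivial direction, the torsion subgroup embeds in one of the
-- finite groups B_v by (A2), hence is killed by some N > 0, and the hypothesis
-- gives N (x² P + y² Q) ≡ 0 mod v.  A set of positive density is never covered
-- by a finite list, since the family is infinite; so the primes v of (A1) can be
-- chosen outside the exceptional ones.
--
-- If P and Q were independent, take a prime l ∤ N and v with l ∥ ord_v P and
-- l² ∥ ord_v Q: then l divides y and x, which are coprime.  Hence a P + b Q is
-- torsion for some nonzero coprime a, b, and eliminating Q modulo v yields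
-- ord_v P ∣ N² (b x² − a y²).  Taking ord_v P divisible by high powers of l, the
-- congruence b x² ≡ a y² has solutions primitive at l modulo all powers of every
-- prime l.  Descent then shows that a and b are squares up to a common unit.

module Submission where

open import Defs
open import Algebra.Bundles using (AbelianGroup)
open import Algebra.Morphism.Bundles using (GroupHomomorphism)
import Algebra.Properties.AbelianGroup as AbelianGroupProperties
import Algebra.Properties.CommutativeMonoid.Mult as Mult
import Algebra.Properties.Group as GroupProperties
open import Axiom.ExcludedMiddle using (ExcludedMiddle)
open import Data.Fin.Base as Fin using (Fin; toℕ)
import Data.Fin.Properties as Fin
open import Data.Integer.Base as ℤ using (ℤ; +_; -[1+_]; +[1+_]; 0ℤ; 1ℤ; -1ℤ; ∣_∣; _⊖_; _+_; _*_; _-_; -_; _^_)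
open import Data.Integer.Coprimality using (Coprime)
open import Data.Integer.DivMod using (_/ℕ_; _%ℕ_; a≡a%ℕn+[a/ℕn]*n; n%ℕd<d)
open import Data.Integer.Divisibility.Signed
import Data.Integer.GCD as ℤ
import Data.Integer.Properties as ℤ
open import Data.Integer.Tactic.RingSolver using (solve-∀)
open import Data.List.Base using (List; []; _∷_; length)
open import Data.List.Membership.Propositional using (_∈_; _∉_)
open import Data.List.Membership.Setoid.Properties using (index-injective)
open import Data.List.Relation.Unary.All using (_∷_)
open import Data.List.Relation.Unary.Any using (here; there; index)
open import Data.Nat.Base as ℕ using (ℕ; zero; suc; _!)
import Data.Nat.Divisibility as ℕ
import Data.Nat.DivMod as ℕ
open import Data.Nat.Induction using (Acc; acc; <-wellFounded)
open import Data.Nat.ListAction using (product)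
open import Data.Nat.Primality using (Prime; euclidsLemma; prime⇒irreducible; prime⇒nonZero; prime⇒nonTrivial; prime[2])
open import Data.Nat.Primality.Factorisation using (factorise)
import Data.Nat.Properties as ℕ
open import Data.Product.Base using (∃-syntax; _×_; _,_; proj₁; proj₂; uncurry)
open import Data.Rational.Base as ℚ using (0ℚ; ½)
import Data.Rational.Properties as ℚ
import Data.Rational.Unnormalised.Base as ℚᵘ
import Data.Rational.Unnormalised.Properties as ℚᵘ
open import Data.Sum.Base as Sum using (_⊎_; inj₁; inj₂; [_,_]′)
open import Data.Vec.Functional as Vector using (Vector)
open import Function.Base using (_∘_; id)
open import Function.Bundles using (_⇔_; mk⇔)
open import Function.Definitions using (Injective)
open import Relation.Binary using (tri<; tri≈; tri>)
open import Relation.Binary.PropositionalEquality as ≡ using (_≡_; _≢_; cong; subst; subst₂)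
open import Relation.Nullary using (¬_; yes; no; contradiction)
open import Relation.Nullary.Decidable using (decidable-stable)
open import Relation.Unary as U using (Pred; _≐_)

-- Divisibility of integers by prime powers

pos-^ : ∀ m n → + (m ℕ.^ n) ≡ (+ m) ^ n
pos-^ m zero    = ≡.refl
pos-^ m (suc n) = ≡.trans (ℤ.pos-* m (m ℕ.^ n)) (cong (+ m *_) (pos-^ m n))

≢1⇒∃prime∣ : ∀ n → n ≢ 0 → n ≢ 1 → ∃[ p ] (Prime p × p ℕ.∣ n)
≢1⇒∃prime∣ n n≢0 n≢1
  with factorise n {{ℕ.≢-nonZero n≢0}}
... | record { factors = []     ; isFactorisation = n≡1 } = contradiction n≡1 n≢1
... | record { factors = p ∷ ps ; isFactorisation = eq ; factorsPrime = pr ∷ _ } =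
  p , pr , ℕ.divides (product ps) (≡.trans eq (ℕ.*-comm p (product ps)))

prime∤1 : ∀ {l} → Prime l → ¬ (l ℕ.∣ 1)
prime∤1 pl l∣1 = ℕ.nonTrivial⇒≢1 {{prime⇒nonTrivial pl}} (ℕ.∣1⇒≡1 l∣1)

module _ {l} (pl : Prime l) where

  private instance
    _ = prime⇒nonZero pl

  euclid : ∀ i j → + l ∣ i * j → (+ l ∣ i) ⊎ (+ l ∣ j)
  euclid i j l∣ij = Sum.map ∣ᵤ⇒∣ ∣ᵤ⇒∣
    (euclidsLemma ∣ i ∣ ∣ j ∣ pl (subst (l ℕ.∣_) (ℤ.abs-* i j) (∣⇒∣ᵤ l∣ij)))

  euclid-square : ∀ i → + l ∣ i * i → + l ∣ i
  euclid-square i = [ id , id ]′ ∘ euclid i i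

  coprime⇒∤ : ∀ {i j} → Coprime i j → + l ∣ i → ¬ (+ l ∣ j)
  coprime⇒∤ cop l∣i l∣j =
    prime∤1 pl (ℕ.∣-reflexive (cop (∣⇒∣ᵤ l∣i , ∣⇒∣ᵤ l∣j)))

  -- One factor `l` at a time: Euclid's lemma forces it into `j`, and cancelling it leaves the same
  -- claim for `k`.
  ^-cancel-∣ : ∀ k i j → ¬ (+ l ∣ i) → (+ l) ^ k ∣ i * j → (+ l) ^ k ∣ j
  ^-cancel-∣ zero    i j l∤i _   = ∣ᵤ⇒∣ (ℕ.1∣ ∣ j ∣)
  ^-cancel-∣ (suc k) i j l∤i lᵏ⁺¹∣ij
    with euclid i j (∣-trans (∣m⇒∣m*n ((+ l) ^ k) ∣-refl) lᵏ⁺¹∣ij)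
  ... | inj₁ l∣i = contradiction l∣i l∤i
  ... | inj₂ (divides h ≡.refl) = subst ((+ l) ^ suc k ∣_) (ℤ.*-comm (+ l) h)
    (*-monoʳ-∣ (+ l) (^-cancel-∣ k i h l∤i
      (*-cancelˡ-∣ (+ l) (subst ((+ l) ^ suc k ∣_) (shift i h (+ l)) lᵏ⁺¹∣ij))))
    where
    shift : ∀ i h l → i * (h * l) ≡ l * (i * h)
    shift = solve-∀

  -- n has at most n prime factors l, so dividing by n costs at most lⁿ.
  ^-absorb : ∀ k n j → n ≢ 0 → (+ l) ^ (k ℕ.+ n) ∣ + n * j → (+ l) ^ k ∣ j
  ^-absorb k n j n≢0 = go n (<-wellFounded n) n≢0 ℕ.≤-refl
    where
    lᵏ∣lᵏ⁺ : ∀ m → (+ l) ^ k ∣ (+ l) ^ (k ℕ.+ m)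
    lᵏ∣lᵏ⁺ m = subst ((+ l) ^ k ∣_) (≡.sym (ℤ.^-distribˡ-+-* (+ l) k m)) (∣m⇒∣m*n _ ∣-refl)

    go : ∀ n → Acc ℕ._<_ n → n ≢ 0 → ∀ {m} → n ℕ.≤ m →
         (+ l) ^ (k ℕ.+ m) ∣ + n * j → (+ l) ^ k ∣ j
    go n (acc rec) n≢0 {m} n≤m d with l ℕ.∣? n
    ... | no l∤n = ^-cancel-∣ k (+ n) j (l∤n ∘ ∣⇒∣ᵤ) (∣-trans (lᵏ∣lᵏ⁺ m) d)
    ... | yes (ℕ.divides zero eq) = contradiction eq n≢0
    ... | yes (ℕ.divides h@(suc h′) ≡.refl) = step m n≤m d
      where
      h<hl : h ℕ.< h ℕ.* l
      h<hl = ℕ.m<m*n h l (ℕ.nonTrivial⇒n>1 l {{prime⇒nonTrivial pl}})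

      shift : ∀ h l j → (h * l) * j ≡ l * (h * j)
      shift = solve-∀

      step : ∀ m → h ℕ.* l ℕ.≤ m → (+ l) ^ (k ℕ.+ m) ∣ + (h ℕ.* l) * j → (+ l) ^ k ∣ j
      step zero    hl≤0 _ = contradiction (ℕ.<-≤-trans h<hl hl≤0) ℕ.n≮0
      -- A factor `l` of `n` is traded for one in the exponent; `h < h * l ≤ suc m` keeps the bound
      -- `h ≤ m`.
      step (suc m) hl≤m d = go h (rec h<hl) (λ ()) (ℕ.s≤s⁻¹ (ℕ.<-≤-trans h<hl hl≤m))
        (*-cancelˡ-∣ (+ l) (subst₂ _∣_ (cong ((+ l) ^_) (ℕ.+-suc k m))
          (≡.trans (cong (_* j) (ℤ.pos-* h l)) (shift (+ h) (+ l) j)) d))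

-- Descent on a conic

-- The conic b x² = a y² has a solution, primitive at l, modulo every power of l.
LocallySolvable : ℤ → ℤ → Set
LocallySolvable a b = ∀ l → Prime l → ∀ k → ∃[ x ] ∃[ y ]
  (¬ ((+ l ∣ x) × (+ l ∣ y)) × (+ l) ^ k ∣ b * (x * x) - a * (y * y))

locallySolvable-sym : ∀ {a b} → LocallySolvable a b → LocallySolvable b a
locallySolvable-sym {a} {b} ls l pl k with ls l pl k
... | x , y , prim , d = y , x , (λ (p , q) → prim (q , p)) ,
  subst ((+ l) ^ k ∣_) (eq a b x y) (∣m⇒∣-m d)
  where
  eq : ∀ a b x y → - (b * (x * x) - a * (y * y)) ≡ a * (y * y) - b * (x * x)
  eq = solve-∀

module _ {a b l} (pl : Prime l) (l∣a : + l ∣ a) (cop : Coprime a b) (ls : LocallySolvable a b) where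

  private instance
    _ = prime⇒nonZero pl

  -- Modulo `l` the conic reduces to `b x² ≡ 0`, and `l` cannot divide `b` because `a` and `b` are
  -- coprime.
  ∣a⇒∣x : ∀ k {x y} → (+ l) ^ suc k ∣ b * (x * x) - a * (y * y) → + l ∣ x
  ∣a⇒∣x k {x} {y} d with euclid pl b (x * x)
    (∣m+n∣n⇒∣m (∣-trans (∣m⇒∣m*n ((+ l) ^ k) ∣-refl) d) (∣m⇒∣-m (∣m⇒∣m*n (y * y) l∣a)))
  ... | inj₁ l∣b  = contradiction l∣b (coprime⇒∤ pl cop l∣a)
  ... | inj₂ l∣xx = euclid-square pl x l∣xx

  -- Solvability modulo `l²` suffices: `l` divides `x`, so `l²` divides `a y²`, and primitivity
  -- keeps `l` from dividing `y`.
  square∣ : + l * + l ∣ a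
  square∣ with ls l pl 2
  ... | x , y , prim , d with ∣a⇒∣x 1 {x} {y} d
  ... | l∣x₁@(divides h ≡.refl) = subst (_∣ a) (l² (+ l))
    (^-cancel-∣ pl 2 (y * y) a (λ l∣yy → prim (l∣x₁ , euclid-square pl y l∣yy))
      (subst ((+ l) ^ 2 ∣_) (eq a b y h (+ l))
        (∣m∣n⇒∣m-n (∣n⇒∣m*n (b * (h * h)) (∣-refl {(+ l) ^ 2})) d)))
    where
    l² : ∀ l → l * (l * 1ℤ) ≡ l * l
    l² = solve-∀
    eq : ∀ a b y h l → b * (h * h) * (l * (l * 1ℤ)) - (b * ((h * l) * (h * l)) - a * (y * y))
                     ≡ (y * y) * a
    eq = solve-∀

  -- At `l` itself, a solution modulo `l ^ (2 + k)` has `x = h l`, and the whole congruence can be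
  -- divided by `l²`; the new pair is primitive because `l ∤ y`. At any other prime `q`, the factor
  -- `l` moves into `y` without spoiling primitivity.
  locallySolvable-/ : ∀ {a′} → a ≡ a′ * (+ l * + l) → LocallySolvable a′ b
  locallySolvable-/ {a′} ≡.refl q pq k with q ℕ.≟ l
  ... | yes ≡.refl with ls l pl (2 ℕ.+ k)
  ...   | x , y , prim , d with ∣a⇒∣x (suc k) {x} {y} d
  ...   | l∣x₁@(divides h ≡.refl) = h , y , (λ (_ , l∣y) → prim (l∣x₁ , l∣y)) ,
          *-cancelˡ-∣ (+ l) (*-cancelˡ-∣ (+ l) (subst ((+ l) ^ (2 ℕ.+ k) ∣_) (eq a′ b y h (+ l)) d))
          where
          eq : ∀ a b y h l → b * ((h * l) * (h * l)) - (a * (l * l)) * (y * y)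
                           ≡ l * (l * (b * (h * h) - a * (y * y)))
          eq = solve-∀
  locallySolvable-/ {a′} ≡.refl q pq k | no q≢l with ls q pq k
  ... | x , y , prim , d = x , + l * y , prim′ , subst ((+ q) ^ k ∣_) (eq a′ b x y (+ l)) d
    where
    eq : ∀ a b x y l → b * (x * x) - (a * (l * l)) * (y * y)
                     ≡ b * (x * x) - a * ((l * y) * (l * y))
    eq = solve-∀

    q∤l : ¬ (+ q ∣ + l)
    q∤l q∣l = [ (λ { ≡.refl → prime∤1 pq (ℕ.∣-refl) }) , q≢l ]′
      (prime⇒irreducible pl (∣⇒∣ᵤ q∣l))

    prim′ : ¬ ((+ q ∣ x) × (+ q ∣ + l * y))
    prim′ (q∣x , q∣ly) = [ q∤l , (λ q∣y → prim (q∣x , q∣y)) ]′ (euclid pq (+ l) y q∣ly)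

-- Descent on `∣ a ∣`: by `square∣` every prime factor occurs at least twice, and dividing by its
-- square preserves local solvability. That property is returned for the unit too, so that the same
-- descent can then be run on `b`.
unit*square : ∀ {a b} → a ≢ 0ℤ → Coprime a b → LocallySolvable a b →
  ∃[ u ] ∃[ s ] (a ≡ u * (s * s) × ∣ u ∣ ≡ 1 × LocallySolvable u b)
unit*square {a} {b} a≢0 cop ls = go a (<-wellFounded ∣ a ∣) a≢0 cop ls
  where
  UnitTimesSquare : ℤ → Set
  UnitTimesSquare a = ∃[ u ] ∃[ s ] (a ≡ u * (s * s) × ∣ u ∣ ≡ 1 × LocallySolvable u b)

  go : ∀ a → Acc ℕ._<_ ∣ a ∣ → a ≢ 0ℤ → Coprime a b → LocallySolvable a b →
       UnitTimesSquare a
  go a (acc rec) a≢0 cop ls with ∣ a ∣ ℕ.≟ 1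
  ... | yes a≡1 = a , 1ℤ , ≡.sym (ℤ.*-identityʳ a) , a≡1 , ls
  ... | no  a≢1 with ≢1⇒∃prime∣ ∣ a ∣ (a≢0 ∘ ℤ.∣i∣≡0⇒i≡0) a≢1
  ... | l , pl , l∣a with square∣ {a} {b} pl (∣ᵤ⇒∣ l∣a) cop ls
  ... | divides a′ ≡.refl = extend (go a′ (rec a′<a) a′≢0 cop′ ls′)
    where
    a′≢0 : a′ ≢ 0ℤ
    a′≢0 ≡.refl = a≢0 ≡.refl

    cop′ : Coprime a′ b
    cop′ (d∣a′ , d∣b) = cop (ℕ.∣-trans d∣a′ (∣⇒∣ᵤ (divides (+ l * + l) (ℤ.*-comm a′ _))) , d∣b)

    ls′ : LocallySolvable a′ b
    ls′ = locallySolvable-/ {a} {b} pl (∣ᵤ⇒∣ l∣a) cop ls {a′} ≡.refl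

    a′<a : ∣ a′ ∣ ℕ.< ∣ a′ * (+ l * + l) ∣
    a′<a = subst (∣ a′ ∣ ℕ.<_)
      (≡.sym (≡.trans (ℤ.abs-* a′ (+ l * + l)) (cong (∣ a′ ∣ ℕ.*_) (ℤ.abs-* (+ l) (+ l)))))
      (ℕ.m<m*n ∣ a′ ∣ (l ℕ.* l) {{ℕ.≢-nonZero (a′≢0 ∘ ℤ.∣i∣≡0⇒i≡0)}}
        (ℕ.<-≤-trans (ℕ.nonTrivial⇒n>1 l {{prime⇒nonTrivial pl}})
                     (ℕ.m≤m*n l l {{prime⇒nonZero pl}})))

    shift : ∀ u s l → u * (s * s) * (l * l) ≡ u * ((s * l) * (s * l))
    shift = solve-∀

    extend : UnitTimesSquare a′ → UnitTimesSquare (a′ * (+ l * + l))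
    extend (u , s , ≡.refl , rest) = u , s * + l , shift u s (+ l) , rest

even⊎odd : ∀ i → ∃[ h ] (i ≡ h * + 2 ⊎ i ≡ 1ℤ + h * + 2)
even⊎odd i with i %ℕ 2 | a≡a%ℕn+[a/ℕn]*n i 2 | n%ℕd<d i 2
... | 0 | eq | _ = i /ℕ 2 , inj₁ (≡.trans eq (ℤ.+-identityˡ _))
... | 1 | eq | _ = i /ℕ 2 , inj₂ eq
... | suc (suc _) | _ | ℕ.s≤s (ℕ.s≤s ())

4∣remainder : ∀ {i} r q → i ≡ r + q * + 4 → + 4 ∣ i → 4 ℕ.∣ ∣ r ∣
4∣remainder r q ≡.refl d = ∣⇒∣ᵤ (∣m+n∣n⇒∣m {m = r} d (divides q ≡.refl))

-- -1 is not a square modulo 4.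
4∣x²+y²⇒even : ∀ x y → + 4 ∣ x * x + y * y → (+ 2 ∣ x) × (+ 2 ∣ y)
4∣x²+y²⇒even x y d with even⊎odd x | even⊎odd y
... | h , inj₁ ≡.refl | i , inj₁ ≡.refl = divides h ≡.refl , divides i ≡.refl
... | h , inj₁ ≡.refl | i , inj₂ ≡.refl =
  contradiction (4∣remainder 1ℤ (h * h + i * i + i) (eq h i) d) (ℕ.>⇒∤ (ℕ.s≤s (ℕ.s≤s ℕ.z≤n)))
  where
  eq : ∀ h i → h * + 2 * (h * + 2) + (1ℤ + i * + 2) * (1ℤ + i * + 2) ≡ 1ℤ + (h * h + i * i + i) * + 4
  eq = solve-∀
... | h , inj₂ ≡.refl | i , inj₁ ≡.refl =
  contradiction (4∣remainder 1ℤ (h * h + i * i + h) (eq h i) d) (ℕ.>⇒∤ (ℕ.s≤s (ℕ.s≤s ℕ.z≤n)))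
  where
  eq : ∀ h i → (1ℤ + h * + 2) * (1ℤ + h * + 2) + i * + 2 * (i * + 2) ≡ 1ℤ + (h * h + i * i + h) * + 4
  eq = solve-∀
... | h , inj₂ ≡.refl | i , inj₂ ≡.refl =
  contradiction (4∣remainder (+ 2) (h * h + i * i + h + i) (eq h i) d) (ℕ.>⇒∤ (ℕ.s≤s (ℕ.s≤s (ℕ.s≤s ℕ.z≤n))))
  where
  eq : ∀ h i → (1ℤ + h * + 2) * (1ℤ + h * + 2) + (1ℤ + i * + 2) * (1ℤ + i * + 2) ≡ + 2 + (h * h + i * i + h + i) * + 4
  eq = solve-∀

-- The conic is `x² + y² = 0`, and the prime 2 with exponent 2 obstructs it: both unknowns would be
-- even.
¬locallySolvable[1,-1] : ¬ LocallySolvable 1ℤ -1ℤ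
¬locallySolvable[1,-1] ls with ls 2 prime[2] 2
... | x , y , prim , d = prim (4∣x²+y²⇒even x y (subst (+ 4 ∣_) (eq x y) (∣m⇒∣-m d)))
  where
  eq : ∀ x y → - (-1ℤ * (x * x) - 1ℤ * (y * y)) ≡ x * x + y * y
  eq = solve-∀

units-agree : ∀ {u w} → ∣ u ∣ ≡ 1 → ∣ w ∣ ≡ 1 → LocallySolvable u w → u ≡ w
units-agree {+ 1}       {+ 1}       ≡.refl ≡.refl ls = ≡.refl
units-agree {+ 1}       { -[1+ 0 ]} ≡.refl ≡.refl ls = contradiction ls ¬locallySolvable[1,-1]
units-agree { -[1+ 0 ]} {+ 1}       ≡.refl ≡.refl ls =
  contradiction (locallySolvable-sym { -1ℤ} {1ℤ} ls) ¬locallySolvable[1,-1]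
units-agree { -[1+ 0 ]} { -[1+ 0 ]} ≡.refl ≡.refl ls = ≡.refl

-- Two descents: the first replaces `a` by a unit `u`, the second replaces `b` by a unit `w` against
-- `u`, where coprimality is automatic. Local solvability for the two units then forces equal signs.
localToGlobal : ∀ {a b} → a ≢ 0ℤ → b ≢ 0ℤ → Coprime a b → LocallySolvable a b →
  ∃[ u ] ∃[ s ] ∃[ t ] (∣ u ∣ ≡ 1 × a ≡ u * (s * s) × b ≡ u * (t * t))
localToGlobal {a} {b} a≢0 b≢0 cop ls
  with unit*square {a} {b} a≢0 cop ls
... | u , s , a≡ , ∣u∣≡1 , ls₁
  with unit*square {b} {u} b≢0 (λ (_ , d∣u) → ℕ.∣1⇒≡1 (subst (_ ℕ.∣_) ∣u∣≡1 d∣u))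
         (locallySolvable-sym {u} {b} ls₁)
... | w , t , b≡ , ∣w∣≡1 , ls₂
  with ≡.refl ← units-agree {w} {u} ∣w∣≡1 ∣u∣≡1 ls₂ = u , s , t , ∣u∣≡1 , a≡ , b≡

-- Coprime quotients, units and squares

-- If `d` divides both quotients, then `d` times the gcd divides `i` and `j`, hence the gcd itself.
coprime-quotients : ∀ i j {i′ j′} → ℤ.gcd i j ≢ 0ℤ →
  i ≡ i′ * ℤ.gcd i j → j ≡ j′ * ℤ.gcd i j → Coprime i′ j′
coprime-quotients i j {i′} {j′} g≢0 i≡ j≡ {d} (d∣i′ , d∣j′) = ℕ.∣1⇒≡1 (ℕ.*-cancelʳ-∣ ∣ g ∣
  {{ℕ.≢-nonZero (g≢0 ∘ ℤ.∣i∣≡0⇒i≡0)}}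
  (subst (d ℕ.* ∣ g ∣ ℕ.∣_) (≡.sym (ℕ.*-identityˡ ∣ g ∣))
    (ℤ.gcd-greatest {i} {j} {+ (d ℕ.* ∣ g ∣)} (scale i i′ i≡ d∣i′) (scale j j′ j≡ d∣j′))))
  where
  g = ℤ.gcd i j

  scale : ∀ k k′ → k ≡ k′ * g → d ℕ.∣ ∣ k′ ∣ → d ℕ.* ∣ g ∣ ℕ.∣ ∣ k ∣
  scale k k′ k≡ d∣k′ = subst (d ℕ.* ∣ g ∣ ℕ.∣_)
    (≡.sym (≡.trans (cong ∣_∣ k≡) (ℤ.abs-* k′ g))) (ℕ.*-monoˡ-∣ ∣ g ∣ d∣k′)

divide-by-gcd : ∀ {i} j → i ≢ 0ℤ →
  ∃[ g ] ∃[ i′ ] ∃[ j′ ] (g ≢ 0ℤ × i ≡ i′ * g × j ≡ j′ * g × Coprime i′ j′)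
divide-by-gcd {i} j i≢0
  with ∣ᵤ⇒∣ {ℤ.gcd i j} {i} (ℤ.gcd[i,j]∣i i j) | ∣ᵤ⇒∣ {ℤ.gcd i j} {j} (ℤ.gcd[i,j]∣j i j)
... | divides i′ i≡ | divides j′ j≡ =
  ℤ.gcd i j , i′ , j′ , g≢0 , i≡ , j≡ , coprime-quotients i j {i′} {j′} g≢0 i≡ j≡
  where
  g≢0 : ℤ.gcd i j ≢ 0ℤ
  g≢0 = i≢0 ∘ ℤ.gcd[i,j]≡0⇒i≡0 i j

-- Supplies a prime away from the torsion exponent `N`: any prime factor of `suc N` will do.
∣suc⇒∤ : ∀ {l n} → Prime l → l ℕ.∣ suc n → ¬ (+ l ∣ + n)
∣suc⇒∤ {l} {n} pl l∣1+n l∣n =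
  prime∤1 pl (ℕ.∣m+n∣m⇒∣n (subst (l ℕ.∣_) (ℕ.+-comm 1 n) l∣1+n) (∣⇒∣ᵤ l∣n))

unit-square : ∀ u → ∣ u ∣ ≡ 1 → u * u ≡ 1ℤ
unit-square (+ 1)     ≡.refl = ≡.refl
unit-square -[1+ 0 ]  ≡.refl = ≡.refl

^2≡* : ∀ x → x ^ 2 ≡ x * x
^2≡* x = cong (x *_) (ℤ.*-identityʳ x)

-- Since `u * u ≡ 1ℤ`, one more factor `u` clears the unit.
unit-cancel : ∀ {c} u r → ∣ u ∣ ≡ 1 → c ≡ u * (r * r) → u * c ≡ r ^ 2
unit-cancel u r ∣u∣≡1 ≡.refl = ≡.trans (≡.sym (ℤ.*-assoc u u (r * r)))
  (≡.trans (cong (_* (r * r)) (unit-square u ∣u∣≡1))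
    (≡.trans (ℤ.*-identityˡ (r * r)) (≡.sym (^2≡* r))))

square-factor-coprime : ∀ {a b} u s t → a ≡ u * (s * s) → b ≡ u * (t * t) → Coprime a b → Coprime s t
square-factor-coprime u s t ≡.refl ≡.refl cop (d∣s , d∣t) =
  cop (ℕ.∣-trans d∣s (∣⇒∣ᵤ (root∣ s)) , ℕ.∣-trans d∣t (∣⇒∣ᵤ (root∣ t)))
  where
  root∣ : ∀ r → r ∣ u * (r * r)
  root∣ r = ∣n⇒∣m*n u {r * r} (∣n⇒∣m*n r {r} ∣-refl)

-- Integer multiples and orders in abelian groups

module ActionProperties {a ℓ} (G : AbelianGroup a ℓ) where
  open AbelianGroup G hiding (_-_)
  open ℤ-Action G
  open AbelianGroupProperties G
  open Mult commutativeMonoid using (×-congʳ; ×-homo-+; ×-assocˡ; ×-distrib-+)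
  open import Relation.Binary.Reasoning.Setoid setoid
  open import Algebra.Properties.CommutativeSemigroup commutativeSemigroup using (interchange)

  ·-congˡ : ∀ z {g h} → g ≈ h → z · g ≈ z · h
  ·-congˡ (+ n)    g≈h = ×-congʳ n g≈h
  ·-congˡ -[1+ n ] g≈h = ⁻¹-cong (×-congʳ (suc n) g≈h)

  ·-congʳ : ∀ {i j} g → i ≡ j → i · g ≈ j · g
  ·-congʳ g i≡j = reflexive (cong (_· g) i≡j)

  -- Addition of integers of opposite sign computes to `_⊖_`, so this carries the mixed cases of
  -- `·-homo-+`. The inductive step slips in `g ∙ g ⁻¹`.
  ·-homo-⊖ : ∀ m n g → (m ⊖ n) · g ≈ m ×ᴳ g ∙ (n ×ᴳ g) ⁻¹
  ·-homo-⊖ m zero g = sym (trans (∙-congˡ ε⁻¹≈ε) (identityʳ _))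
  ·-homo-⊖ zero (suc n) g = sym (identityˡ _)
  ·-homo-⊖ (suc m) (suc n) g = begin
    (suc m ⊖ suc n) · g                ≈⟨ ·-congʳ g (ℤ.[1+m]⊖[1+n]≡m⊖n m n) ⟩
    (m ⊖ n) · g                        ≈⟨ ·-homo-⊖ m n g ⟩
    m ×ᴳ g ∙ (n ×ᴳ g) ⁻¹               ≈⟨ identityˡ _ ⟨
    ε ∙ (m ×ᴳ g ∙ (n ×ᴳ g) ⁻¹)         ≈⟨ ∙-congʳ (inverseʳ g) ⟨
    g ∙ g ⁻¹ ∙ (m ×ᴳ g ∙ (n ×ᴳ g) ⁻¹)  ≈⟨ interchange g (g ⁻¹) _ _ ⟩
    g ∙ m ×ᴳ g ∙ (g ⁻¹ ∙ (n ×ᴳ g) ⁻¹)  ≈⟨ ∙-congˡ (⁻¹-∙-comm g _) ⟩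
    g ∙ m ×ᴳ g ∙ (g ∙ n ×ᴳ g) ⁻¹       ∎

  ·-homo-+ : ∀ i j g → (i + j) · g ≈ i · g ∙ j · g
  ·-homo-+ (+ m)    (+ n)    g = ×-homo-+ g m n
  ·-homo-+ (+ m)    -[1+ n ] g = ·-homo-⊖ m (suc n) g
  ·-homo-+ -[1+ m ] (+ n)    g = trans (·-homo-⊖ n (suc m) g) (comm _ _)
  ·-homo-+ -[1+ m ] -[1+ n ] g = begin
    (suc (suc (m ℕ.+ n)) ×ᴳ g) ⁻¹        ≈⟨ ⁻¹-cong (·-congʳ g (cong (+_ ∘ suc) (≡.sym (ℕ.+-suc m n)))) ⟩
    ((suc m ℕ.+ suc n) ×ᴳ g) ⁻¹          ≈⟨ ⁻¹-cong (×-homo-+ g (suc m) (suc n)) ⟩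
    (suc m ×ᴳ g ∙ suc n ×ᴳ g) ⁻¹         ≈⟨ ⁻¹-∙-comm _ _ ⟨
    (suc m ×ᴳ g) ⁻¹ ∙ (suc n ×ᴳ g) ⁻¹    ∎

  ·-homo-neg : ∀ i g → (- i) · g ≈ (i · g) ⁻¹
  ·-homo-neg (+ zero)  g = sym ε⁻¹≈ε
  ·-homo-neg +[1+ n ]  g = refl
  ·-homo-neg -[1+ n ]  g = sym (⁻¹-involutive _)

  ·-assoc-+ : ∀ n j g → (+ n * j) · g ≈ n ×ᴳ (j · g)
  ·-assoc-+ zero    j g = refl
  ·-assoc-+ (suc n) j g = begin
    (+[1+ n ] * j) · g       ≈⟨ ·-congʳ g (ℤ.suc-* (+ n) j) ⟩
    (j + + n * j) · g        ≈⟨ ·-homo-+ j (+ n * j) g ⟩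
    j · g ∙ (+ n * j) · g    ≈⟨ ∙-congˡ (·-assoc-+ n j g) ⟩
    suc n ×ᴳ (j · g)         ∎

  ·-assoc : ∀ i j g → (i * j) · g ≈ i · (j · g)
  ·-assoc (+ n)    j g = ·-assoc-+ n j g
  ·-assoc -[1+ n ] j g = begin
    (-[1+ n ] * j) · g       ≈⟨ ·-congʳ g (ℤ.neg-distribˡ-* +[1+ n ] j) ⟨
    (- (+[1+ n ] * j)) · g   ≈⟨ ·-homo-neg (+[1+ n ] * j) g ⟩
    ((+[1+ n ] * j) · g) ⁻¹  ≈⟨ ⁻¹-cong (·-assoc-+ (suc n) j g) ⟩
    -[1+ n ] · (j · g)       ∎

  ·-comm : ∀ i j g → i · (j · g) ≈ j · (i · g)
  ·-comm i j g = trans (sym (·-assoc i j g)) (trans (·-congʳ g (ℤ.*-comm i j)) (·-assoc j i g))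

  ·-distribˡ-∙ : ∀ i g h → i · (g ∙ h) ≈ i · g ∙ i · h
  ·-distribˡ-∙ (+ n)    g h = ×-distrib-+ g h n
  ·-distribˡ-∙ -[1+ n ] g h = trans (⁻¹-cong (×-distrib-+ g h (suc n))) (sym (⁻¹-∙-comm _ _))

  ·-zeroʳ : ∀ i → i · ε ≈ ε
  ·-zeroʳ i = trans (·-comm i 0ℤ ε) refl

  ·-annihilates : ∀ i {g} → g ≈ ε → i · g ≈ ε
  ·-annihilates i g≈ε = trans (·-congˡ i g≈ε) (·-zeroʳ i)

  ∣·∣-annihilates : ∀ i {g} → i · g ≈ ε → ∣ i ∣ ×ᴳ g ≈ ε
  ∣·∣-annihilates (+ n)    ig≈ε = ig≈ε
  ∣·∣-annihilates -[1+ n ] ig≈ε = ⁻¹-injective (trans ig≈ε (sym ε⁻¹≈ε))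

  annihilated⇒torsion : ∀ {i g} → i ≢ 0ℤ → i · g ≈ ε → IsTorsion g
  annihilated⇒torsion {i} i≢0 ig≈ε = ∣ i ∣ , ℕ.n≢0⇒n>0 (i≢0 ∘ ℤ.∣i∣≡0⇒i≡0) , ∣·∣-annihilates i ig≈ε

  ε-torsion : IsTorsion ε
  ε-torsion = 1 , ℕ.z<s , identityʳ ε

  ·-torsion : ∀ i {g} → IsTorsion g → IsTorsion (i · g)
  ·-torsion i {g} (n , 0<n , ng≈ε) = n , 0<n ,
    trans (·-comm (+ n) i g) (·-annihilates i ng≈ε)

  ·-∣-annihilates : ∀ {i j g} → i · g ≈ ε → i ∣ j → j · g ≈ ε
  ·-∣-annihilates {i} {g = g} ig≈ε (divides q ≡.refl) = trans (·-assoc q i g) (·-annihilates q ig≈ε)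

  -- The remainder of `∣ i ∣` modulo `n` also annihilates `g` and is below `n`, so minimality of `n`
  -- makes it zero.
  order-∣ : ∀ {g n i} → IsOrder g n → i · g ≈ ε → + n ∣ i
  order-∣ {g} {n} {i} (0<n , ng≈ε , least) ig≈ε = ∣ᵤ⇒∣ (ℕ.m%n≡0⇒n∣m m n r≡0)
    where
    instance
      _ : ℕ.NonZero n
      _ = ℕ.>-nonZero 0<n
    m = ∣ i ∣
    rg≈ε : (m ℕ.% n) ×ᴳ g ≈ ε
    rg≈ε = begin
      (m ℕ.% n) ×ᴳ g                               ≈⟨ identityʳ _ ⟨
      (m ℕ.% n) ×ᴳ g ∙ ε                           ≈⟨ ∙-congˡ (·-annihilates (+ (m ℕ./ n)) ng≈ε) ⟨
      (m ℕ.% n) ×ᴳ g ∙ (m ℕ./ n) ×ᴳ (n ×ᴳ g)       ≈⟨ ∙-congˡ (×-assocˡ g (m ℕ./ n) n) ⟩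
      (m ℕ.% n) ×ᴳ g ∙ (m ℕ./ n ℕ.* n) ×ᴳ g        ≈⟨ ×-homo-+ g (m ℕ.% n) (m ℕ./ n ℕ.* n) ⟨
      (m ℕ.% n ℕ.+ m ℕ./ n ℕ.* n) ×ᴳ g             ≈⟨ ·-congʳ g (cong +_ (ℕ.m≡m%n+[m/n]*n m n)) ⟨
      m ×ᴳ g                                       ≈⟨ ∣·∣-annihilates i ig≈ε ⟩
      ε                                            ∎
    r≡0 : m ℕ.% n ≡ 0
    r≡0 with m ℕ.% n ℕ.≟ 0
    ... | yes eq = eq
    ... | no r≢0 = contradiction (ℕ.m%n<n m n)
            (ℕ.≤⇒≯ (least _ (ℕ.n≢0⇒n>0 r≢0) rg≈ε))

  combine : ∀ k i j {g h} → i · g ∙ j · h ≈ ε → (k * i) · g ∙ (k * j) · h ≈ ε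
  combine k i j {g} {h} eq = begin
    (k * i) · g ∙ (k * j) · h    ≈⟨ ∙-cong (·-assoc k i g) (·-assoc k j h) ⟩
    k · (i · g) ∙ k · (j · h)    ≈⟨ ·-distribˡ-∙ k _ _ ⟨
    k · (i · g ∙ j · h)          ≈⟨ ·-annihilates k eq ⟩
    ε                            ∎

  ∙≈ε∧ˡ : ∀ {g h} → g ∙ h ≈ ε → g ≈ ε → h ≈ ε
  ∙≈ε∧ˡ {g} {h} gh≈ε g≈ε = trans (sym (identityˡ h)) (trans (∙-congʳ (sym g≈ε)) gh≈ε)

  ∙≈ε∧ʳ : ∀ {g h} → g ∙ h ≈ ε → h ≈ ε → g ≈ ε
  ∙≈ε∧ʳ gh≈ε = ∙≈ε∧ˡ (trans (comm _ _) gh≈ε)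

  -- Scaling the relations by `j′` and by `j` gives `h` the same coefficient in both; their
  -- difference no longer contains `h`.
  eliminate : ∀ i j i′ j′ {g h} → i · g ∙ j · h ≈ ε → i′ · g ∙ j′ · h ≈ ε →
    (j′ * i - j * i′) · g ≈ ε
  eliminate i j i′ j′ {g} {h} eq eq′ = begin
    (j′ * i - j * i′) · g                      ≈⟨ ·-homo-+ (j′ * i) (- (j * i′)) g ⟩
    (j′ * i) · g ∙ (- (j * i′)) · g            ≈⟨ ∙-congˡ (·-homo-neg (j * i′) g) ⟩
    (j′ * i) · g ∙ ((j * i′) · g) ⁻¹           ≈⟨ ∙-cong (inverseˡ-unique _ _ (combine j′ i j eq))
                                                    (⁻¹-cong (inverseˡ-unique _ _ (combine j i′ j′ eq′))) ⟩
    ((j′ * j) · h) ⁻¹ ∙ (((j * j′) · h) ⁻¹) ⁻¹  ≈⟨ ∙-congʳ (⁻¹-cong (·-congʳ h (ℤ.*-comm j′ j))) ⟩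
    ((j * j′) · h) ⁻¹ ∙ (((j * j′) · h) ⁻¹) ⁻¹  ≈⟨ inverseʳ _ ⟩
    ε                                          ∎

  -- By pigeonhole two of the `n + 1` multiples of `g` by 0 up to `n` share a representative, so
  -- some `d` with `0 < d ≤ n` annihilates `g`, and `d` divides `n !`.
  finite⇒exponent : ∀ {n} → HasSize _≈_ n → ∀ g → (n !) ×ᴳ g ≈ ε
  finite⇒exponent {n} (f , _ , f-surj) g
    with Fin.pigeonhole (ℕ.n<1+n n) (λ i → proj₁ (f-surj (toℕ i ×ᴳ g)))
  ... | i , j , i<j , eq = ·-∣-annihilates {+ d} {+ (n !)} dg≈ε (∣ᵤ⇒∣ (d∣n! d 0<d d≤n))
    where
    d = toℕ j ℕ.∸ toℕ i
    0<d : 0 ℕ.< d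
    0<d = ℕ.m<n⇒0<n∸m i<j
    d≤n : d ℕ.≤ n
    d≤n = ℕ.≤-trans (ℕ.m∸n≤m (toℕ j) (toℕ i)) (ℕ.s≤s⁻¹ (Fin.toℕ<n j))
    d∣n! : ∀ d → 0 ℕ.< d → d ℕ.≤ n → d ℕ.∣ n !
    d∣n! (suc d) _ d≤n = ℕ.∣-trans (ℕ.m∣m*n (d !)) (ℕ.m≤n⇒m!∣n! d≤n)
    ig≈jg : toℕ i ×ᴳ g ≈ toℕ j ×ᴳ g
    ig≈jg = trans (sym (proj₂ (f-surj _) ≡.refl)) (proj₂ (f-surj _) eq)
    dg≈ε : d ×ᴳ g ≈ ε
    dg≈ε = ∙-cancelʳ (toℕ i ×ᴳ g) _ _ (begin
      d ×ᴳ g ∙ toℕ i ×ᴳ g      ≈⟨ ×-homo-+ g d (toℕ i) ⟨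
      (d ℕ.+ toℕ i) ×ᴳ g       ≈⟨ ·-congʳ g (cong +_ (ℕ.m∸n+n≡m (ℕ.<⇒≤ i<j))) ⟩
      toℕ j ×ᴳ g               ≈⟨ ig≈jg ⟨
      toℕ i ×ᴳ g               ≈⟨ identityˡ _ ⟨
      ε ∙ toℕ i ×ᴳ g           ∎)

module _ {a b ℓ₁ ℓ₂} {G : AbelianGroup a ℓ₁} {H : AbelianGroup b ℓ₂}
  (φ : GroupHomomorphism (AbelianGroup.rawGroup G) (AbelianGroup.rawGroup H)) where
  private
    module G = AbelianGroup G
    module H = AbelianGroup H
    module ·G = ℤ-Action G
    module ·H = ℤ-Action H
  open GroupHomomorphism φ

  ×-homo : ∀ n g → ⟦ n ·G.×ᴳ g ⟧ H.≈ n ·H.×ᴳ ⟦ g ⟧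
  ×-homo zero    g = ε-homo
  ×-homo (suc n) g = H.trans (homo g _) (H.∙-congˡ (×-homo n g))

  ·-homo : ∀ i g → ⟦ i ·G.· g ⟧ H.≈ i ·H.· ⟦ g ⟧
  ·-homo (+ n)    g = ×-homo n g
  ·-homo -[1+ n ] g = H.trans (⁻¹-homo _) (H.⁻¹-cong (×-homo (suc n) g))

-- Orders with prescribed l-part

module _ {l} (pl : Prime l) where

  private instance
    _ = prime⇒nonZero pl

  ∤* : ∀ {i j} → ¬ (+ l ∣ i) → ¬ (+ l ∣ j) → ¬ (+ l ∣ i * j)
  ∤* l∤i l∤j = [ l∤i , l∤j ]′ ∘ euclid pl _ _

  exactPower⇒ : ∀ {k n} → ExactPower l k n →
    ∃[ c ] (+ n ≡ + c * (+ l) ^ k × ¬ (+ l ∣ + c))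
  exactPower⇒ {k} {n} (ℕ.divides c n≡ , lᵏ⁺¹∤n) = c ,
    ≡.trans (cong +_ n≡) (≡.trans (ℤ.pos-* c (l ℕ.^ k)) (cong (+ c *_) (pos-^ l k))) ,
    λ l∣c → lᵏ⁺¹∤n (subst (l ℕ.^ suc k ℕ.∣_) (≡.sym n≡) (ℕ.*-monoˡ-∣ (l ℕ.^ k) (∣⇒∣ᵤ l∣c)))

  -- After `i` is cancelled, the surplus factor `l` beyond `l ^ k` has to come from `j`.
  ^-factor-∣ : ∀ k i j → ¬ (+ l ∣ i) → (+ l) ^ suc k ∣ i * ((+ l) ^ k * j) → + l ∣ j
  ^-factor-∣ k i j l∤i d =
    ∣-trans (∣-reflexive (≡.sym (ℤ.*-identityʳ (+ l)))) (strip k (^-cancel-∣ pl (suc k) i _ l∤i d))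
    where
    strip : ∀ k → (+ l) ^ suc k ∣ (+ l) ^ k * j → (+ l) ^ 1 ∣ j
    strip zero    = subst ((+ l) ^ 1 ∣_) (ℤ.*-identityˡ j)
    strip (suc k) = strip k ∘ *-cancelˡ-∣ (+ l) {(+ l) ^ suc k} {(+ l) ^ k * j} ∘
      subst ((+ l) ^ suc (suc k) ∣_) (ℤ.*-assoc (+ l) ((+ l) ^ k) j)

  -- Multiplying the relation by `m` removes `g` and leaves `l² ∣ m N y²`, where `m` has a single
  -- factor `l`, so `l ∣ y`. Then `l² ∣ y²`, so multiplying by the prime-to-`l` part `d` of `n`
  -- removes `h` and leaves `l ∣ d N x²`.
  independent-orders : ∀ {a ℓ} (G : AbelianGroup a ℓ) →
    let open AbelianGroup G hiding (_-_)
        open ℤ-Action G in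
    ∀ {g h m n} N x y → IsOrder g m → IsOrder h n →
    ExactPower l 1 m → ExactPower l 2 n → ¬ (+ l ∣ N) →
    (N * (x * x)) · g ∙ (N * (y * y)) · h ≈ ε → (+ l ∣ x) × (+ l ∣ y)
  independent-orders G {g} {h} {m} {n} N x y ordg ordh 1∥m 2∥n l∤N eq
    with exactPower⇒ {1} {m} 1∥m | exactPower⇒ {2} {n} 2∥n
  ... | c , m≡ , l∤c | d , n≡ , l∤d = l∣x , l∣y
    where
    open AbelianGroup G using (_≈_; ε)
    open ℤ-Action G
    open ActionProperties G
    L = + l

    m·g≈ε : (+ c * L ^ 1) · g ≈ ε
    m·g≈ε = subst (λ i → i · g ≈ ε) m≡ (proj₁ (proj₂ ordg))

    n·h≈ε : (+ d * L ^ 2) · h ≈ ε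
    n·h≈ε = subst (λ i → i · h ≈ ε) n≡ (proj₁ (proj₂ ordh))

    l∣y : L ∣ y
    l∣y = euclid-square pl y (^-factor-∣ 1 (+ c * N) (y * y) (∤* {+ c} {N} l∤c l∤N)
      (subst (L ^ 2 ∣_) (shift (+ c) L N (y * y))
        (∣-trans (divides (+ d) n≡) (order-∣ {i = k * (N * (y * y))} ordh
          (∙≈ε∧ˡ (combine k (N * (x * x)) (N * (y * y)) eq)
            (·-∣-annihilates {k} {k * (N * (x * x))} m·g≈ε (∣m⇒∣m*n {k} (N * (x * x)) ∣-refl)))))))
      where
      k = + c * L ^ 1
      shift : ∀ c L N z → (c * (L * 1ℤ)) * (N * z) ≡ (c * N) * ((L * 1ℤ) * z)
      shift = solve-∀

    square-∣ : ∀ {z} → L ∣ z → L ^ 2 ∣ z * z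
    square-∣ (divides q ≡.refl) = divides (q * q) (shift q L)
      where
      shift : ∀ q L → (q * L) * (q * L) ≡ q * q * (L * (L * 1ℤ))
      shift = solve-∀

    l∣x : L ∣ x
    l∣x = euclid-square pl x (^-factor-∣ 0 (+ d * N) (x * x) (∤* {+ d} {N} l∤d l∤N)
      (subst (L ^ 1 ∣_) (shift (+ d) N (x * x))
        (∣-trans (divides (+ c) m≡) (order-∣ {i = + d * (N * (x * x))} ordg
          (∙≈ε∧ʳ (combine (+ d) (N * (x * x)) (N * (y * y)) eq)
            (·-∣-annihilates {+ d * L ^ 2} {+ d * (N * (y * y))} n·h≈ε
              (*-monoʳ-∣ (+ d) {L ^ 2} {N * (y * y)} (∣n⇒∣m*n N {y * y} (square-∣ l∣y)))))))))
      where
      shift : ∀ d N z → d * (N * z) ≡ (d * N) * (1ℤ * z)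
      shift = solve-∀

-- Infinite index sets and density

module _ (em : ∀ {a} → ExcludedMiddle a) where

  infinite⇒fresh : ∀ {a} {A : Set a} → ¬ IsFinite A → ∀ xs → ∃[ x ] x ∉ xs
  infinite⇒fresh inf xs = decidable-stable em λ none →
    inf (xs , λ x → decidable-stable em λ x∉xs → none (x , x∉xs))

  -- `e n` is picked outside the list `prefix n` of all earlier values, hence the mutual recursion.
  infinite⇒sequence : ∀ {a} {A : Set a} → ¬ IsFinite A →
    ∃[ e ] Injective {A = ℕ} {B = A} _≡_ _≡_ e
  infinite⇒sequence {A = A} inf = e , e-injective
    where
    prefix : ℕ → List A
    e      : ℕ → A
    prefix zero    = []
    prefix (suc n) = e n ∷ prefix n
    e n = proj₁ (infinite⇒fresh inf (prefix n))

    e∈prefix : ∀ {m n} → m ℕ.<′ n → e m ∈ prefix n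
    e∈prefix ℕ.<′-base       = here ≡.refl
    e∈prefix (ℕ.<′-step m<n) = there (e∈prefix m<n)

    e-≢ : ∀ {m n} → m ℕ.< n → e m ≢ e n
    e-≢ {n = n} m<n eq = proj₂ (infinite⇒fresh inf (prefix n))
      (subst (_∈ prefix n) eq (e∈prefix (ℕ.<⇒<′ m<n)))

    e-injective : Injective _≡_ _≡_ e
    e-injective {m} {n} eq with ℕ.<-cmp m n
    ... | tri< m<n _ _ = contradiction eq (e-≢ m<n)
    ... | tri≈ _ m≡n _ = m≡n
    ... | tri> _ _ n<m = contradiction (≡.sym eq) (e-≢ n<m)

bounded : ∀ (f : ℕ → ℕ) n → ∃[ M ] (∀ {i} → i ℕ.< n → f i ℕ.≤ M)
bounded f zero    = 0 , λ ()
bounded f (suc n) with bounded f n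
... | M , f≤M = M ℕ.⊔ f n , λ {i} i<1+n → helper (ℕ.m<1+n⇒m<n∨m≡n i<1+n)
  where
  helper : ∀ {i} → (i ℕ.< n ⊎ i ≡ n) → f i ℕ.≤ M ℕ.⊔ f n
  helper (inj₁ i<n)  = ℕ.≤-trans (f≤M i<n) (ℕ.m≤m⊔n M (f n))
  helper (inj₂ ≡.refl) = ℕ.m≤n⊔m M (f n)

reciprocal-bound : ∀ η → 0ℚ ℚ.< η → ∃[ D ] (∀ s t → s ℕ.* D ℕ.≤ suc t → + s ℚ./ suc t ℚ.≤ η)
reciprocal-bound (ℚ.mkℚ (+ 0)      d c) (ℚ.*<* (ℤ.+<+ ()))
reciprocal-bound (ℚ.mkℚ ℤ.-[1+ _ ] d c) (ℚ.*<* ())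
-- With `η = (p + 1) / (d + 1)` the denominator serves as `D`, because
-- `s (d + 1) ≤ t + 1 ≤ (p + 1)(t + 1)`.
reciprocal-bound η@(ℚ.mkℚ +[1+ p ] d _) _ = suc d , λ s t sD≤t →
  ℚ.toℚᵘ-cancel-≤ (ℚᵘ.≤-trans (ℚᵘ.≤-reflexive (ℚ.toℚᵘ-fromℚᵘ (ℚᵘ.mkℚᵘ (+ s) t)))
    (ℚᵘ.*≤* (subst₂ ℤ._≤_ (ℤ.pos-* s (suc d)) (ℤ.pos-* (suc p) (suc t))
      (ℤ.+≤+ (ℕ.≤-trans sD≤t (ℕ.m≤m+n (suc t) (p ℕ.* suc t)))))))

-- Contradicts a limit taken with tolerance `½ * δ`, once the counting ratio `p` is too small for
-- the density approximation `q`.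
half-close : ∀ {p q δ} → δ ℚ.≤ q → p ℚ.≤ ½ ℚ.* δ → ½ ℚ.* δ ℚ.≤ ℚ.∣ p ℚ.- q ∣
half-close {p} {q} {δ} δ≤q p≤½δ = begin
  ½ ℚ.* δ                         ≡⟨ //-rightDividesʳ (½ ℚ.* δ) (½ ℚ.* δ) ⟨
  ½ ℚ.* δ ℚ.+ ½ ℚ.* δ ℚ.- ½ ℚ.* δ ≡⟨ cong (ℚ._- ½ ℚ.* δ) half+half ⟩
  δ ℚ.- ½ ℚ.* δ                   ≤⟨ ℚ.+-mono-≤ δ≤q (ℚ.neg-antimono-≤ p≤½δ) ⟩
  q ℚ.- p                         ≤⟨ p≤∣p∣ (q ℚ.- p) ⟩
  ℚ.∣ q ℚ.- p ∣                   ≡⟨ cong ℚ.∣_∣ (⁻¹-anti-homo-// p q) ⟨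
  ℚ.∣ ℚ.- (p ℚ.- q) ∣             ≡⟨ ℚ.∣-p∣≡∣p∣ (p ℚ.- q) ⟩
  ℚ.∣ p ℚ.- q ∣                   ∎
  where
  open ℚ.≤-Reasoning
  open GroupProperties ℚ.+-0-group using (⁻¹-anti-homo-//; //-rightDividesʳ)
  half+half : ½ ℚ.* δ ℚ.+ ½ ℚ.* δ ≡ δ
  half+half = ≡.trans (≡.sym (ℚ.*-distribʳ-+ δ ½ ½)) (ℚ.*-identityˡ δ)
  p≤∣p∣ : ∀ x → x ℚ.≤ ℚ.∣ x ∣
  p≤∣p∣ x@(ℚ.mkℚ (+ _) _ _) = ℚ.≤-refl
  p≤∣p∣ x@(ℚ.mkℚ ℤ.-[1+ _ ] _ _) = ℚ.*≤* ℤ.-≤+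

module _ {ℓ} {F : NumberField ℓ} {B : AbelianGroup ℓ ℓ} (ρ : ReductionFamily F B) where
  open ReductionFamily ρ

  -- Each counted prime comes from an index in `xs`, whose position determines the prime up to
  -- `_≐_`; irredundancy of the count makes these positions distinct.
  countUpTo≤length : ∀ {N x s} {S : Pred V ℓ} xs → (∀ v → v U.∈ S → v ∈ xs) →
    CountUpTo F N (primesOf S) x s → s ℕ.≤ length xs
  countUpTo≤length {S = S} xs S⊆xs (f , f-inj , _) = Fin.injective⇒≤ {f = pos} pos-injective
    where
    member = λ i → proj₁ (proj₂ (f i))
    v∈xs   = λ i → S⊆xs _ (proj₁ (proj₂ (member i)))
    pos    = λ i → index (v∈xs i)

    pos-injective : Injective _≡_ _≡_ pos
    pos-injective {i} {j} eq = f-inj (same (index-injective (≡.setoid V) (v∈xs i) (v∈xs j) eq)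
      (proj₂ (proj₂ (member i))) (proj₂ (proj₂ (member j))))
      where
      same : ∀ {I J : Pred _ _} {v w} → v ≡ w → I ≐ ideal (toPrime v) → J ≐ ideal (toPrime w) → I ≐ J
      same ≡.refl (a , b) (c , d) = (λ z → d (a z)) , (λ z → b (c z))

  -- Completeness of the count gives the prime of each `e i` a place in it, and no place repeats
  -- because `toPrime` separates indices.
  ≤countUpTo : ∀ {N x t} (e : ℕ → V) → Injective _≡_ _≡_ e → ∀ n →
    (∀ {i} → i ℕ.< n → N (toPrime (e i)) ℕ.≤ x) → CountUpTo F N U.U x t → n ℕ.≤ t
  ≤countUpTo {t = t} e e-inj n e≤x (f , _ , f-surj) = Fin.injective⇒≤ {f = pos} pos-injective
    where
    preimage = λ (i : Fin n) → f-surj (toPrime (e (toℕ i)) , _ , e≤x (Fin.toℕ<n i))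
    pos : Fin n → Fin t
    pos i = proj₁ (preimage i)

    pos-injective : Injective _≡_ _≡_ pos
    pos-injective {i} {j} eq = Fin.toℕ-injective (e-inj (injective
      ((λ z → proj₁ q (proj₂ p z)) , (λ z → proj₁ p (proj₂ q z)))))
      where
      p = proj₂ (preimage i) ≡.refl
      q = proj₂ (preimage j) eq

  module _ (em : ∀ {a} → ExcludedMiddle a) where

    -- If `S` lay inside `xs`, the numerators would stay below a bound while the denominators grow
    -- with the infinite family. The ratio would drop to `½ * δ`, against approximations that are
    -- eventually at least `δ`.
    positiveDensity⇒cofinal : ∀ {S : Pred V ℓ} {d} → HasDensity F (primesOf S) d → Positive d →
      ∀ xs → ∃[ v ] (v U.∈ S × v ∉ xs)
    positiveDensity⇒cofinal {S} {d} (N , _ , lim) (δ , 0<δ , M , δ≤d) xs =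
      decidable-stable em λ none → absurd λ v v∈S →
        decidable-stable em λ v∉xs → none (v , v∈S , v∉xs)
      where
      ½δ = ½ ℚ.* δ
      0<½δ : 0ℚ ℚ.< ½δ
      0<½δ = subst (ℚ._< ½δ) (ℚ.*-zeroʳ ½) (ℚ.*-monoʳ-<-pos ½ 0<δ)

      absurd : ¬ (∀ v → v U.∈ S → v ∈ xs)
      absurd S⊆xs
        with reciprocal-bound ½δ 0<½δ | infinite⇒sequence em infinite | lim ½δ 0<½δ
      ... | D , s/t≤½δ | e , e-inj | X , close
        -- The first `length xs * D` primes of the sequence have norm at most `Y`, so a cutoff
        -- beyond `Y` makes the denominator at least `length xs * D`.
        with bounded (λ i → N (toPrime (e i))) (length xs ℕ.* D)
      ... | Y , e≤Y with close (X ℕ.+ Y) (ℕ.m≤m+n X Y)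
      ... | s , t , #S , #U , near = ℚ.<-irrefl ≡.refl (ℚ.<-≤-trans (near (X ℕ.+ M) (ℕ.m≤m+n X M))
        (half-close (δ≤d (X ℕ.+ M) (ℕ.m≤n+m M X)) (s/t≤½δ s t (ℕ.≤-trans
          (ℕ.*-monoˡ-≤ D (countUpTo≤length {N} xs S⊆xs #S))
          (≤countUpTo {N} e e-inj (length xs ℕ.* D)
            (λ i<n → ℕ.≤-trans (e≤Y i<n) (ℕ.m≤n+m Y X)) #U)))))

-- Relations between points and their reductions

module _ (em : ∀ {a} → ExcludedMiddle a) {ℓ} {F : NumberField ℓ} {B : AbelianGroup ℓ ℓ}
  (ρ : ReductionFamily F B) (A1 : AssumptionA1 ρ) (A2 : AssumptionA2 ρ) where
  open AbelianGroup B hiding (_-_; group)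
  open ℤ-Action B
  open ActionProperties B
  open ReductionFamily ρ

  private
    module Bᵥ (v : V) where
      open AbelianGroup (group v) public using ()
        renaming (_≈_ to infix 4 _≈ᵥ_; _∙_ to infixl 7 _∙ᵥ_; ε to εᵥ; ∙-cong to ∙-congᵥ)
      open ℤ-Action (group v) public using () renaming (_·_ to infixr 8 _·ᵥ_)

  red-· : ∀ v → let open Bᵥ v in ∀ i g → red v (i · g) ≈ᵥ i ·ᵥ red v g
  red-· v i g = ·-homo {G = B} {H = group v} (reduction v) i g

  -- Positive density is what leaves a prime of (A1) outside the given finite list.
  prescribedOrders : ∀ {l} → Prime l → ∀ {m} → 1 ℕ.≤ m → (k : Vector ℕ m) (P : Vector Carrier m) →
    LinearlyIndependent P → ∀ xs → ∃[ v ] (v ∉ xs × (∀ i → ∃[ n ] (IsOrd v (P i) n ×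
      (0 ℕ.< k i → ExactPower l (k i) n))))
  prescribedOrders {l} pl {m} 1≤m k P ind xs =
    let S , (d , density , positive) , orders = A1 l pl m 1≤m k P ind
        v , v∈S , v∉xs = positiveDensity⇒cofinal ρ em {S} {d} density positive xs
    in v , v∉xs , λ i → let n , ord , exact , _ = orders v v∈S i in n , ord , exact

  -- `(n !) · T` is itself torsion and reduces to the identity at a `v` allowed by (A2), so
  -- injectivity on torsion kills it. The exponent is uniform because `v` is chosen before `T`.
  torsionExponent : ∃[ N ] (N ≢ 0 × (∀ {T} → IsTorsion T → (+ N) · T ≈ ε))
  torsionExponent with infinite⇒fresh em infinite (proj₁ A2)
  ... | v , v∉xs with finite v
  ... | n , size = n ! , ℕ.≢-nonZero⁻¹ (n !) {{n ℕ.!≢0}} , λ {T} T-tors →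
    proj₂ A2 v v∉xs (·-torsion (+ (n !)) T-tors) ε-torsion
      (G.trans (red-· v (+ (n !)) T)
        (G.trans (ActionProperties.finite⇒exponent (group v) size (red v T)) (G.sym ε-homo)))
    where
    module G = AbelianGroup (group v)
    open GroupHomomorphism (reduction v) using (ε-homo)

  module _ {N} (N≢0 : N ≢ 0) (N-kills : ∀ {T} → IsTorsion T → (+ N) · T ≈ ε) where

    -- Multiplication by `N` clears `T`, whichever torsion point it is, and leaves a homogeneous
    -- relation.
    relation-mod : ∀ v i j {P Q T} → IsTorsion T → (i · P ∙ j · Q) ≈[ v ] T →
      let open Bᵥ v in (+ N * i) ·ᵥ red v P ∙ᵥ (+ N * j) ·ᵥ red v Q ≈ᵥ εᵥ
    relation-mod v i j {P} {Q} {T} T-tors eq = begin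
      (+ N * i) ·ᵥ red v P ∙ᵥ (+ N * j) ·ᵥ red v Q
        ≈⟨ ∙-congᵥ (Aᵥ.·-assoc (+ N) i _) (Aᵥ.·-assoc (+ N) j _) ⟩
      (+ N) ·ᵥ (i ·ᵥ red v P) ∙ᵥ (+ N) ·ᵥ (j ·ᵥ red v Q)
        ≈⟨ Aᵥ.·-distribˡ-∙ (+ N) _ _ ⟨
      (+ N) ·ᵥ (i ·ᵥ red v P ∙ᵥ j ·ᵥ red v Q)
        ≈⟨ Aᵥ.·-congˡ (+ N) (∙-congᵥ (red-· v i P) (red-· v j Q)) ⟨
      (+ N) ·ᵥ (red v (i · P) ∙ᵥ red v (j · Q))
        ≈⟨ Aᵥ.·-congˡ (+ N) (homo (i · P) (j · Q)) ⟨
      (+ N) ·ᵥ red v (i · P ∙ j · Q)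
        ≈⟨ Aᵥ.·-congˡ (+ N) eq ⟩
      (+ N) ·ᵥ red v T
        ≈⟨ red-· v (+ N) T ⟨
      red v ((+ N) · T)
        ≈⟨ ⟦⟧-cong (N-kills T-tors) ⟩
      red v ε
        ≈⟨ ε-homo ⟩
      εᵥ ∎
      where
      open GroupHomomorphism (reduction v) using (homo; ⟦⟧-cong; ε-homo)
      module Aᵥ = ActionProperties (group v)
      open Bᵥ v
      open import Relation.Binary.Reasoning.Setoid (AbelianGroup.setoid (group v))

    module _ {P Q : Carrier} (P∞ : InfiniteOrder P) (Q∞ : InfiniteOrder Q)
      (local : AllButFinitelyMany λ v → ∃[ x ] ∃[ y ] ∃[ T ] (Coprime x y × IsTorsion T ×
        ((x ^ 2) · P ∙ (y ^ 2) · Q) ≈[ v ] T)) where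

      infiniteOrder⇒≡0 : ∀ {g i} → InfiniteOrder g → i · g ≈ ε → i ≡ 0ℤ
      infiniteOrder⇒≡0 {i = i} g∞ ig≈ε = decidable-stable (i ℤ.≟ 0ℤ) λ i≢0 → g∞ (annihilated⇒torsion i≢0 ig≈ε)

      local-relation : ∀ v → v ∉ proj₁ local → let open Bᵥ v in
        ∃[ x ] ∃[ y ] (Coprime x y × (+ N * (x * x)) ·ᵥ red v P ∙ᵥ (+ N * (y * y)) ·ᵥ red v Q ≈ᵥ εᵥ)
      local-relation v v∉ with proj₂ local v v∉
      ... | x , y , T , cop , T-tors , eq = x , y , cop ,
        subst₂ (λ i j → (+ N * i) ·ᵥ red v P ∙ᵥ (+ N * j) ·ᵥ red v Q ≈ᵥ εᵥ) (^2≡* x) (^2≡* y)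
          (relation-mod v (x ^ 2) (y ^ 2) T-tors eq)
        where
        open Bᵥ v

      ¬independent : ¬ LinearlyIndependent (P Vector.∷ Q Vector.∷ Vector.[])
      ¬independent ind =
        let l , pl , l∣1+N = ≢1⇒∃prime∣ (suc N) (λ ()) (N≢0 ∘ ℕ.suc-injective)
            v , v∉xs , orders = prescribedOrders pl (ℕ.s≤s ℕ.z≤n) (1 Vector.∷ 2 Vector.∷ Vector.[])
              (P Vector.∷ Q Vector.∷ Vector.[]) ind (proj₁ local)
            x , y , cop , eq = local-relation v v∉xs
            m , ordP , 1∥m = orders Fin.zero
            n , ordQ , 2∥n = orders (Fin.suc Fin.zero)
        in uncurry (coprime⇒∤ pl {x} {y} cop) (independent-orders pl (group v) (+ N) x y
             ordP ordQ (1∥m ℕ.z<s) (2∥n ℕ.z<s) (∣suc⇒∤ pl l∣1+N) eq)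

      -- In a nontrivial relation neither coefficient can vanish: otherwise the other one would
      -- annihilate a point of infinite order and vanish too.
      dependence : ∃[ a ] ∃[ b ] (a ≢ 0ℤ × b ≢ 0ℤ × a · P ∙ b · Q ≈ ε)
      dependence = decidable-stable em λ none → ¬independent λ c eq i →
        decidable-stable (c i ℤ.≟ 0ℤ) λ ci≢0 → none (nonzero (c Fin.zero) (c (Fin.suc Fin.zero))
          -- The sum over `Fin 2` ends in `ε`, which has to be stripped.
          (trans (∙-congˡ (sym (identityʳ (c (Fin.suc Fin.zero) · Q)))) eq)
          λ a≡0 b≡0 → ci≢0 (vanish c a≡0 b≡0 i))
        where
        vanish : ∀ (c : Fin 2 → ℤ) → c Fin.zero ≡ 0ℤ → c (Fin.suc Fin.zero) ≡ 0ℤ → ∀ i → c i ≡ 0ℤ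
        vanish c p q Fin.zero           = p
        vanish c p q (Fin.suc Fin.zero) = q

        nonzero : ∀ a b → a · P ∙ b · Q ≈ ε → (a ≡ 0ℤ → b ≢ 0ℤ) →
          ∃[ a ] ∃[ b ] (a ≢ 0ℤ × b ≢ 0ℤ × a · P ∙ b · Q ≈ ε)
        nonzero a b eq ab≢0 = a , b ,
          (λ a≡0 → ab≢0 a≡0 (infiniteOrder⇒≡0 {Q} {b} Q∞ (∙≈ε∧ˡ {a · P} {b · Q} eq (·-congʳ {a} {0ℤ} P a≡0)))) ,
          (λ b≡0 → ab≢0 (infiniteOrder⇒≡0 {P} {a} P∞ (∙≈ε∧ʳ {a · P} {b · Q} eq (·-congʳ {b} {0ℤ} Q b≡0))) b≡0) , eq

      -- Dividing a relation by the gcd `g` is valid only up to `g`-torsion, so the new one holds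
      -- modulo torsion.
      coprime-dependence : ∃[ a ] ∃[ b ] (a ≢ 0ℤ × b ≢ 0ℤ × Coprime a b × IsTorsion (a · P ∙ b · Q))
      coprime-dependence =
        let a , b , a≢0 , b≢0 , eq = dependence
            g , a′ , b′ , g≢0 , a≡ , b≡ , cop = divide-by-gcd {a} b a≢0
        in a′ , b′ , factor≢0 a≡ a≢0 , factor≢0 b≡ b≢0 , cop , annihilated⇒torsion g≢0 (begin
          g · (a′ · P ∙ b′ · Q)          ≈⟨ ·-distribˡ-∙ g _ _ ⟩
          g · (a′ · P) ∙ g · (b′ · Q)    ≈⟨ ∙-cong (rescale a a′ g P a≡) (rescale b b′ g Q b≡) ⟩
          a · P ∙ b · Q                  ≈⟨ eq ⟩
          ε                              ∎)
        where
        open import Relation.Binary.Reasoning.Setoid setoid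

        rescale : ∀ c c′ g R → c ≡ c′ * g → g · (c′ · R) ≈ c · R
        rescale c c′ g R c≡ = trans (·-comm g c′ R)
          (trans (sym (·-assoc c′ g R)) (·-congʳ {c′ * g} {c} R (≡.sym c≡)))

        factor≢0 : ∀ {c c′ g} → c ≡ c′ * g → c ≢ 0ℤ → c′ ≢ 0ℤ
        factor≢0 {g = g} c≡ c≢0 c′≡0 = c≢0 (≡.trans c≡ (cong (_* g) c′≡0))

      -- Eliminating `Q` between the global relation and the local one makes the order of `P` at `v`
      -- a divisor of `N² (b x² - a y²)`; (A1) for `P` alone makes that order as divisible by `l` as
      -- desired.
      locallySolvable : ∀ {a b} → IsTorsion (a · P ∙ b · Q) → LocallySolvable a b
      locallySolvable {a} {b} T-tors l pl k =
        -- The extra `N * N` is what `^-absorb` consumes in removing the factor `N²`. It also keeps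
        -- the exponent positive when `k` is 0, so that exact divisibility is available.
        let v , v∉xs , orders = prescribedOrders pl {1} (ℕ.s≤s ℕ.z≤n) (λ _ → k ℕ.+ N ℕ.* N) (λ _ → P)
              (λ { c eq Fin.zero → infiniteOrder⇒≡0 P∞ (trans (sym (identityʳ _)) eq) }) (proj₁ local)
            x , y , cop , eq = local-relation v v∉xs
            n , ordP , exact = orders Fin.zero
            n∣ = ActionProperties.order-∣ (group v) ordP
              (ActionProperties.eliminate (group v) (+ N * (x * x)) (+ N * (y * y)) (+ N * a) (+ N * b) eq
                -- The torsion point is `a · P ∙ b · Q` itself, so the congruence is reflexivity.
                (relation-mod v a b T-tors (AbelianGroup.refl (group v))))
            lᵏ⁺∣n = subst (_∣ + n) (pos-^ l (k ℕ.+ N ℕ.* N))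
              (∣ᵤ⇒∣ (proj₁ (exact (ℕ.<-≤-trans (ℕ.n≢0⇒n>0 N²≢0) (ℕ.m≤n+m _ k)))))
        in x , y , uncurry (coprime⇒∤ pl {x} {y} cop) ,
           ^-absorb pl k (N ℕ.* N) (b * (x * x) - a * (y * y)) N²≢0
             (∣-trans lᵏ⁺∣n (subst (+ n ∣_) (N²-factor x y) n∣))
        where
        N²≢0 : N ℕ.* N ≢ 0
        N²≢0 = ℕ.≢-nonZero⁻¹ (N ℕ.* N) {{ℕ.m*n≢0 N N {{ℕ.≢-nonZero N≢0}} {{ℕ.≢-nonZero N≢0}}}}

        shift : ∀ N a b x y → (N * b) * (N * x) - (N * y) * (N * a) ≡ (N * N) * (b * x - a * y)
        shift = solve-∀

        N²-factor : ∀ x y → (+ N * b) * (+ N * (x * x)) - (+ N * (y * y)) * (+ N * a)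
                          ≡ + (N ℕ.* N) * (b * (x * x) - a * (y * y))
        N²-factor x y = ≡.trans (shift (+ N) a b (x * x) (y * y))
          (cong (_* (b * (x * x) - a * (y * y))) (≡.sym (ℤ.pos-* N N)))

      -- Multiplying `a · P ∙ b · Q` by `u` turns both coefficients into squares and keeps the point
      -- torsion, so `T` is that multiple.
      unitMultiple⇒solution : ∀ {a b u s t} → ∣ u ∣ ≡ 1 → a ≡ u * (s * s) → b ≡ u * (t * t) →
        Coprime a b → IsTorsion (a · P ∙ b · Q) →
        ∃[ x ] ∃[ y ] ∃[ T ] (Coprime x y × IsTorsion T × (x ^ 2) · P ∙ (y ^ 2) · Q ≈ T)
      unitMultiple⇒solution {a} {b} {u} {s} {t} ∣u∣≡1 a≡ b≡ cop T-tors =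
        s , t , u · (a · P ∙ b · Q) , square-factor-coprime u s t a≡ b≡ cop , ·-torsion u T-tors , (begin
          (s ^ 2) · P ∙ (t ^ 2) · Q
            ≈⟨ ∙-cong (·-congʳ P (unit-cancel u s ∣u∣≡1 a≡)) (·-congʳ Q (unit-cancel u t ∣u∣≡1 b≡)) ⟨
          (u * a) · P ∙ (u * b) · Q      ≈⟨ ∙-cong (·-assoc u a P) (·-assoc u b Q) ⟩
          u · (a · P) ∙ u · (b · Q)      ≈⟨ ·-distribˡ-∙ u _ _ ⟨
          u · (a · P ∙ b · Q)            ∎)
        where
        open import Relation.Binary.Reasoning.Setoid setoid

      globalSolution : ∃[ x ] ∃[ y ] ∃[ T ] (Coprime x y × IsTorsion T × (x ^ 2) · P ∙ (y ^ 2) · Q ≈ T)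
      globalSolution =
        let a , b , a≢0 , b≢0 , cop , T-tors = coprime-dependence
            u , s , t , ∣u∣≡1 , a≡ , b≡ = localToGlobal {a} {b} a≢0 b≢0 cop (locallySolvable {a} {b} T-tors)
        in unitMultiple⇒solution {a} {b} {u} {s} {t} ∣u∣≡1 a≡ b≡ cop T-tors

theorem2p1 :
  (∀ {a} → ExcludedMiddle a) →
  ∀ {ℓ} (F : NumberField ℓ) (B : AbelianGroup ℓ ℓ) (ρ : ReductionFamily F B) →
  AssumptionA1 ρ → AssumptionA2 ρ →
  let open AbelianGroup B
      open ℤ-Action B
      open ReductionFamily ρ in
  ∀ (P Q : Carrier) → InfiniteOrder P → InfiniteOrder Q →
  (AllButFinitelyMany λ v →
    ∃[ x ] ∃[ y ] ∃[ T ] (Coprime x y × IsTorsion T ×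
      ((x ^ 2) · P ∙ (y ^ 2) · Q) ≈[ v ] T))
  ⇔
  (∃[ x ] ∃[ y ] ∃[ T ] (Coprime x y × IsTorsion T ×
    ((x ^ 2) · P ∙ (y ^ 2) · Q) ≈ T))
theorem2p1 em F B ρ A1 A2 P Q P∞ Q∞ = mk⇔ globalise localise
  where
  open ReductionFamily ρ using (reduction)

  globalise = λ local →
    let N , N≢0 , N-kills = torsionExponent em ρ A1 A2
    in globalSolution em ρ A1 A2 N≢0 N-kills P∞ Q∞ local

  -- A global solution reduces at every `v`, so the exceptional list is empty.
  localise = λ (x , y , T , cop , T-tors , eq) → [] , λ v _ →
    x , y , T , cop , T-tors , GroupHomomorphism.⟦⟧-cong (reduction v) eq
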